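{- There is no boolean query of (Extended Regular) XPath over $2$-data trees which is true in exactly those $2$-data trees $(t,d_1,d_2)$ that satisfy the property $$\psi=\forall x\,\forall y\quad d_1(x)=d_1(y)\iff d_2(x)=d_2(y).$$
   Context: Trees are finite, unranked, sibling-ordered, with nodes labeled by a finite nonempty alphabet (words are the special case of trees where each node has at most one child). Fix an infinite set of data values. A $2$-data tree $(t,d_1,d_2)$ consists of a tree $t$ over a finite alphabet and two functions $d_1,d_2$ from the nodes of $t$ to data values. Extended Regular XPath (called XPath for short) over $2$-data trees is defined inductively. (i) Let $\Gamma$ be a finite set of already defined unary XPath queries (empty in the induction base), and let $\varphi[x_1,\dots,x_m]$ be a formula of monadic second-order logic (with quantification over nodes and sets of nodes) that uses the queries of $\Gamma$ as unary predicates, unary predicates for the letters of the alphabet, and the binary child and next-sibling predicates, but makes no reference to data values other than inside the queries of $\Gamma$. Then $\varphi$ is an $m$-ary XPath query (boolean if $m=0$). (ii) If $\varphi[x,y_1,y_2]$ is a ternary XPath query and $i,j\in\{1,2\}$, then $\exists y_1\exists y_2\ (d_i(y_1)=d_j(y_2)\wedge\varphi[x,y_1,y_2])$ and $\exists y_1\exists y_2\ (d_i(y_1)\neq d_j(y_2)\wedge\varphi[x,y_1,y_2])$ are unary XPath queries (with free variable $x$). -}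

module Defs where

open import Data.Bool using (Bool; T)
open import Data.Fin using (Fin; toℕ)
open import Data.Fin.Patterns using (0F; 1F)
open import Data.List using (List; length; lookup)
open import Data.Nat using (ℕ; suc)
open import Data.Product using (∃-syntax; _×_)
open import Data.Sum using (_⊎_)
open import Data.Vec as Vec using (Vec; []; _∷_)
open import Function.Bundles using (_⇔_)
open import Relation.Binary.PropositionalEquality using (_≡_; _≢_)
open import Relation.Nullary using (¬_)

data Tree (A : Set) : Set where
  node : A → List (Tree A) → Tree A

rootLabel : ∀ {A} → Tree A → A
rootLabel (node a _) = a

children : ∀ {A} → Tree A → List (Tree A)
children (node _ ts) = ts

-- A node is the path leading to it from the root.
data Node {A : Set} (t : Tree A) : Set where
  root  : Node t
  below : (i : Fin (length (children t))) → Node (lookup (children t) i) → Node t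

label : ∀ {A} {t : Tree A} → Node t → A
label {t = t} root = rootLabel t
label (below _ x)  = label x

data Child {A : Set} : {t : Tree A} → Node t → Node t → Set where
  top  : ∀ {t : Tree A} i → Child {t = t} root (below i root)
  down : ∀ {t : Tree A} i {x y} → Child x y → Child {t = t} (below i x) (below i y)

-- NextSibling x y: y is the sibling immediately to the right of x.
data NextSibling {A : Set} : {t : Tree A} → Node t → Node t → Set where
  top  : ∀ {t : Tree A} i j → toℕ j ≡ suc (toℕ i) →
         NextSibling {t = t} (below i root) (below j root)
  down : ∀ {t : Tree A} i {x y} → NextSibling x y →
         NextSibling {t = t} (below i x) (below i y)

record DataTree (A D : Set) : Set where
  field
    tree  : Tree A
    d₁ d₂ : Node tree → D

  d : Fin 2 → Node tree → D
  d 0F = d₁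
  d 1F = d₂

-- MSO A p m s: formulas over the letters A and p further unary predicates, with
-- m free node variables and s free set variables (de Bruijn indices).
data MSO (A : Set) (p : ℕ) : (m s : ℕ) → Set where
  letter              : ∀ {m s} → A → Fin m → MSO A p m s
  pred                : ∀ {m s} → Fin p → Fin m → MSO A p m s
  child nextSibling   : ∀ {m s} → Fin m → Fin m → MSO A p m s
  equal               : ∀ {m s} → Fin m → Fin m → MSO A p m s
  member              : ∀ {m s} → Fin m → Fin s → MSO A p m s
  not                 : ∀ {m s} → MSO A p m s → MSO A p m s
  and or implies      : ∀ {m s} → MSO A p m s → MSO A p m s → MSO A p m s
  existsNode allNodes : ∀ {m s} → MSO A p (suc m) s → MSO A p m s
  existsSet  allSets  : ∀ {m s} → MSO A p m (suc s) → MSO A p m s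

-- Trees have finitely many nodes, so Bool-valued functions represent all sets of nodes.
NodeSet : ∀ {A} → Tree A → Set
NodeSet t = Node t → Bool

holds : ∀ {A p m s} (t : Tree A) → (Fin p → Node t → Set) → MSO A p m s →
        Vec (Node t) m → Vec (NodeSet t) s → Set
holds t P (letter a x)      ρ σ = label (Vec.lookup ρ x) ≡ a
holds t P (pred q x)        ρ σ = P q (Vec.lookup ρ x)
holds t P (child x y)       ρ σ = Child (Vec.lookup ρ x) (Vec.lookup ρ y)
holds t P (nextSibling x y) ρ σ = NextSibling (Vec.lookup ρ x) (Vec.lookup ρ y)
holds t P (equal x y)       ρ σ = Vec.lookup ρ x ≡ Vec.lookup ρ y
holds t P (member x X)      ρ σ = T (Vec.lookup σ X (Vec.lookup ρ x))
holds t P (not φ)           ρ σ = ¬ holds t P φ ρ σ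
holds t P (and φ χ)         ρ σ = holds t P φ ρ σ × holds t P χ ρ σ
holds t P (or φ χ)          ρ σ = holds t P φ ρ σ ⊎ holds t P χ ρ σ
holds t P (implies φ χ)     ρ σ = holds t P φ ρ σ → holds t P χ ρ σ
holds t P (existsNode φ)    ρ σ = ∃[ x ] holds t P φ (x ∷ ρ) σ
holds t P (allNodes φ)      ρ σ = ∀ x → holds t P φ (x ∷ ρ) σ
holds t P (existsSet φ)     ρ σ = ∃[ X ] holds t P φ ρ (X ∷ σ)
holds t P (allSets φ)       ρ σ = ∀ X → holds t P φ ρ (X ∷ σ)

-- XPath A m: m-ary queries. In mso, the family Γ is the finite set of unary queries
-- usable as predicates. In dataEq and dataNeq, the variables 0, 1, 2 of the ternary
-- query are x, y₁, y₂.
data XPath (A : Set) : ℕ → Set where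
  mso     : ∀ {p m} (Γ : Fin p → XPath A 1) → MSO A p m 0 → XPath A m
  dataEq  : (i j : Fin 2) → XPath A 3 → XPath A 1
  dataNeq : (i j : Fin 2) → XPath A 3 → XPath A 1

module _ {A D : Set} (𝒯 : DataTree A D) where
  open DataTree 𝒯

  satisfies : ∀ {m} → XPath A m → Vec (Node tree) m → Set
  satisfies (mso Γ φ) ρ = holds tree (λ q x → satisfies (Γ q) (x ∷ [])) φ ρ []
  satisfies (dataEq i j φ) (x ∷ []) =
    ∃[ y₁ ] ∃[ y₂ ] (d i y₁ ≡ d j y₂ × satisfies φ (x ∷ y₁ ∷ y₂ ∷ []))
  satisfies (dataNeq i j φ) (x ∷ []) =
    ∃[ y₁ ] ∃[ y₂ ] (d i y₁ ≢ d j y₂ × satisfies φ (x ∷ y₁ ∷ y₂ ∷ []))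

  ψ : Set
  ψ = ∀ x y → (d₁ x ≡ d₁ y) ⇔ (d₂ x ≡ d₂ y)

infix 4 _⊨_

_⊨_ : ∀ {A D} → DataTree A D → XPath A 0 → Set
𝒯 ⊨ φ = satisfies 𝒯 φ []

{-# OPTIONS --safe #-}

-- Take a root with two equally long chains a₀ a₁ … and b₀ b₁ … below it, and let d₁
-- and d₂ both assign i to aᵢ and bᵢ, but with disjoint ranges, so that ψ holds. For a
-- fixed query, the Feferman–Vaught type of a position within its own chain, with all
-- nested queries as predicates, ranges over a finite set that does not depend on the
-- length of the chains. So two depths p ≠ q have equal types in both chains. Exchanging
-- the d₂-values of b_p and b_q falsifies ψ, but no query notices. Data tests on y₁ and
-- y₂ within one chain are unaffected. If y₁ and y₂ lie in different chains, one of them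
-- is alone in its chain among x, y₁, y₂, and exchanging p and q in that one preserves
-- all types and compensates for the exchange of values.
module Submission where

open import Data.Bool using (Bool; T)
open import Data.Empty using (⊥)
open import Data.Fin using (Fin; zero; suc; toℕ; combine; funToFin; finToFun)
import Data.Fin as Fin
open import Data.Fin.Patterns using (0F; 1F; 2F)
open import Data.Fin.Properties
  using (any?; pigeonhole; combine-injective; finToFun-funToFin; toℕ-injective;
         inj⇒≟; <⇒≢; suc-injective)
open import Data.Fin.Subset using (Subset)
open import Data.Fin.Subset.Properties using (anySubset?)
open import Data.List using ([]; _∷_)
open import Data.Maybe using (Maybe; just; nothing)
import Data.Maybe as Maybe
open import Data.Maybe.Properties using (just-injective; map-injective)
open import Data.Nat using (ℕ; zero; suc; _+_; _*_; _^_)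
open import Data.Nat.Properties using (n<1+n)
open import Data.Product using (∃; ∃-syntax; _×_; _,_; proj₁; proj₂)
import Data.Product as Product
open import Data.Sum using (_⊎_; inj₁; inj₂)
import Data.Sum as Sum
open import Data.Vec as Vec using (Vec; []; _∷_; replicate; _[_]≔_)
open import Data.Vec.Properties using (lookup-map; lookup∘tabulate; tabulate∘lookup; tabulate-cong)
open import Function using (_∘_; case_of_)
open import Function.Bundles
  using (_↔_; _↣_; _⇔_; mk⇔; mk↔ₛ′; module Equivalence; module Inverse; module Injection)
open import Function.Properties.Inverse using (↔⇒↣; ↔-sym)
import Function.Properties.Equivalence as ⇔
open import Relation.Binary.Definitions using (DecidableEquality)
open import Relation.Binary.PropositionalEquality
open import Relation.Nullary using (¬_; Dec; yes; no; contradiction)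
open import Relation.Nullary.Decidable using (map′; T?; ¬¬-excluded-middle)
open import Defs

open Equivalence using (to; from)

-- Finite codes for truth values, images and tuples

bit : {P : Set} → Dec P → Fin 2
bit (no _)  = 0F
bit (yes _) = 1F

bit-≡ : {P Q : Set} {p? : Dec P} {q? : Dec Q} → bit p? ≡ bit q? → P → Q
bit-≡ {q? = yes q} _ _ = q
bit-≡ {p? = no ¬p} {no _} _ p = contradiction p ¬p

funToFin-injective : ∀ {m n} (f g : Fin m → Fin n) → funToFin f ≡ funToFin g → f ≗ g
funToFin-injective f g e i = begin
  f i                       ≡⟨ finToFun-funToFin f i ⟨
  finToFun (funToFin f) i   ≡⟨ cong (λ k → finToFun k i) e ⟩
  finToFun (funToFin g) i   ≡⟨ finToFun-funToFin g i ⟩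
  g i                       ∎
  where open ≡-Reasoning

-- The characteristic function of the range, packed into one number. The bound depends on `N` alone,
-- however large `X` is.
image : ∀ {X : Set} {N} (f : X → Fin N) → (∀ c → Dec (∃[ x ] f x ≡ c)) → Fin (2 ^ N)
image _ f? = funToFin (bit ∘ f?)

-- This supplies the answering move in a back-and-forth argument.
image-≡ : ∀ {X Y : Set} {N} {f : X → Fin N} {g : Y → Fin N} {f? g?} →
          image f f? ≡ image g g? → ∀ x → ∃[ y ] f x ≡ g y
image-≡ {f = f} {f? = f?} {g?} e x =
  Product.map₂ sym
    (bit-≡ {p? = f? (f x)} {g? (f x)} (funToFin-injective _ _ e (f x)) (x , refl))

∏ : ∀ {p} → (Fin p → ℕ) → ℕ
∏ {zero}  s = 1
∏ {suc p} s = s zero * ∏ (s ∘ suc)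

tuple : ∀ {p} {s : Fin p → ℕ} → ((i : Fin p) → Fin (s i)) → Fin (∏ s)
tuple {zero}  f = zero
tuple {suc p} f = combine (f zero) (tuple (f ∘ suc))

tuple-injective : ∀ {p} {s : Fin p → ℕ} (f g : (i : Fin p) → Fin (s i)) →
                  tuple f ≡ tuple g → ∀ i → f i ≡ g i
tuple-injective f g e zero    = proj₁ (combine-injective (f zero) _ _ _ e)
tuple-injective f g e (suc i) =
  tuple-injective (f ∘ suc) (g ∘ suc) (proj₂ (combine-injective (f zero) _ _ _ e)) i

¬¬-∀Fin : ∀ {p} {P : Fin p → Set} → (∀ i → ¬ ¬ P i) → ¬ ¬ (∀ i → P i)
¬¬-∀Fin {zero}  _ k = k λ ()
¬¬-∀Fin {suc p} h k =
  h zero λ z → ¬¬-∀Fin (h ∘ suc) λ s → k λ { zero → z ; (suc i) → s i }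

≡-resp : ∀ {X : Set} {x x′ y y′ : X} → x ≡ x′ → y ≡ y′ → (x ≡ y) ⇔ (x′ ≡ y′)
≡-resp refl refl = ⇔.refl

-- Transpositions

module Transposition {X : Set} (_≟_ : DecidableEquality X) (p q : X) where

  swap : X → X
  swap u with u ≟ p
  ... | yes _ = q
  ... | no _ with u ≟ q
  ...   | yes _ = p
  ...   | no _  = u

  swap-p : swap p ≡ q
  swap-p with p ≟ p
  ... | yes _ = refl
  ... | no p≢p = contradiction refl p≢p

  swap-q : swap q ≡ p
  swap-q with q ≟ p
  ... | yes q≡p = q≡p
  ... | no _ with q ≟ q
  ...   | yes _ = refl
  ...   | no q≢q = contradiction refl q≢q

  swap-involutive : ∀ u → swap (swap u) ≡ u
  swap-involutive u with u ≟ p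
  ... | yes refl = swap-q
  ... | no u≢p with u ≟ q
  ...   | yes refl = swap-p
  -- The inner `swap u` has now reduced to `u`; the outer one raises the same two tests afresh.
  ...   | no u≢q with u ≟ p
  ...     | yes u≡p = contradiction u≡p u≢p
  ...     | no _ with u ≟ q
  ...       | yes u≡q = contradiction u≡q u≢q
  ...       | no _ = refl

  swap-injective : ∀ {u v} → swap u ≡ swap v → u ≡ v
  swap-injective {u} {v} e =
    trans (sym (swap-involutive u)) (trans (cong swap e) (swap-involutive v))

  swap-invariant : ∀ {Y : Set} (f : X → Y) → f p ≡ f q → ∀ u → f (swap u) ≡ f u
  swap-invariant f e u with u ≟ p
  ... | yes refl = sym e
  ... | no _ with u ≟ q
  ...   | yes refl = e
  ...   | no _ = refl

-- MSO semantics under equivalent predicates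

holds-cong : ∀ {A : Set} {p m s} (t : Tree A) {P Q : Fin p → Node t → Set} →
             (∀ r x → P r x ⇔ Q r x) →
             ∀ (φ : MSO A p m s) ρ σ → holds t P φ ρ σ ⇔ holds t Q φ ρ σ
holds-cong t e (letter a x) ρ σ = ⇔.refl
holds-cong t e (pred r x) ρ σ = e r _
holds-cong t e (child x y) ρ σ = ⇔.refl
holds-cong t e (nextSibling x y) ρ σ = ⇔.refl
holds-cong t e (equal x y) ρ σ = ⇔.refl
holds-cong t e (member x X) ρ σ = ⇔.refl
holds-cong t e (not φ) ρ σ =
  let h = holds-cong t e φ ρ σ in mk⇔ (_∘ from h) (_∘ to h)
holds-cong t e (and φ χ) ρ σ =
  let h = holds-cong t e φ ρ σ; k = holds-cong t e χ ρ σ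
  in mk⇔ (Product.map (to h) (to k)) (Product.map (from h) (from k))
holds-cong t e (or φ χ) ρ σ =
  let h = holds-cong t e φ ρ σ; k = holds-cong t e χ ρ σ
  in mk⇔ (Sum.map (to h) (to k)) (Sum.map (from h) (from k))
holds-cong t e (implies φ χ) ρ σ =
  let h = holds-cong t e φ ρ σ; k = holds-cong t e χ ρ σ
  in mk⇔ (λ f → to k ∘ f ∘ from h) (λ f → from k ∘ f ∘ to h)
holds-cong t e (existsNode φ) ρ σ =
  let h = λ x → holds-cong t e φ (x ∷ ρ) σ
  in mk⇔ (Product.map₂ (to (h _))) (Product.map₂ (from (h _)))
holds-cong t e (allNodes φ) ρ σ =
  let h = λ x → holds-cong t e φ (x ∷ ρ) σ
  in mk⇔ (λ f x → to (h x) (f x)) (λ f x → from (h x) (f x))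
holds-cong t e (existsSet φ) ρ σ =
  let h = λ X → holds-cong t e φ ρ (X ∷ σ)
  in mk⇔ (Product.map₂ (to (h _))) (Product.map₂ (from (h _)))
holds-cong t e (allSets φ) ρ σ =
  let h = λ X → holds-cong t e φ ρ (X ∷ σ)
  in mk⇔ (λ f X → to (h X) (f X)) (λ f X → from (h X) (f X))

-- Bounds on the number of types and colours

size : ∀ {A p m s} → MSO A p m s → ℕ
-- All nodes will carry the same letter, so there is nothing to record.
size (letter _ _)      = 1
size (pred _ _)        = 2
size (child _ _)       = 2
size (nextSibling _ _) = 2
size (equal _ _)       = 2
size (member _ _)      = 2
size (not φ)           = size φ
size (and φ χ)         = size φ * size χ
size (or φ χ)          = size φ * size χ
size (implies φ χ)     = size φ * size χ
-- The power counts sets of types reached by nodes inside the chain; the other factor is for a node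
-- outside. A set needs no second factor, as it always has a trace in the chain.
size (existsNode φ)    = 2 ^ size φ * size φ
size (allNodes φ)      = 2 ^ size φ * size φ
size (existsSet φ)     = 2 ^ size φ
size (allSets φ)       = 2 ^ size φ

-- One type for each of the 2 chains and `m` variables, together with the colours for the nested
-- queries. Only the query enters, so the chain length can be chosen afterwards.
total : ∀ {A m} → XPath A m → ℕ
total (mso {m = m} Γ φ) = (size φ ^ m) ^ 2 * ∏ (λ r → total (Γ r))
total (dataEq _ _ φ)    = total φ
total (dataNeq _ _ φ)   = total φ

-- Chains with a single letter

module Chains {A : Set} (a : A) where

  chain : ℕ → Tree A
  chain zero    = node a []
  chain (suc n) = node a (chain n ∷ [])

  index : ∀ n → Node (chain n) → Fin (suc n)
  index n       root         = zero
  index (suc n) (below 0F u) = suc (index n u)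

  nodeAt : ∀ n → Fin (suc n) → Node (chain n)
  nodeAt n       zero    = root
  nodeAt (suc n) (suc i) = below 0F (nodeAt n i)

  index-nodeAt : ∀ n i → index n (nodeAt n i) ≡ i
  index-nodeAt n       zero    = refl
  index-nodeAt (suc n) (suc i) = cong suc (index-nodeAt n i)

  nodeAt-index : ∀ n u → nodeAt n (index n u) ≡ u
  nodeAt-index n       root         = refl
  nodeAt-index (suc n) (below 0F u) = cong (below 0F) (nodeAt-index n u)

  child? : ∀ n (u v : Node (chain n)) → Dec (Child u v)
  child? zero    root         root                  = no λ ()
  child? (suc n) root         root                  = no λ ()
  child? (suc n) root         (below 0F root)       = yes (top 0F)
  child? (suc n) root         (below 0F (below _ _)) = no λ ()
  child? (suc n) (below 0F u) root                  = no λ ()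
  child? (suc n) (below 0F u) (below 0F v)          =
    map′ (down 0F) (λ { (down _ c) → c }) (child? n u v)

  chain-¬nextSibling : ∀ n {u v : Node (chain n)} → ¬ NextSibling u v
  chain-¬nextSibling (suc n) (top 0F 0F ())
  chain-¬nextSibling (suc n) (down 0F s) = chain-¬nextSibling n s

  label-chain : ∀ n (u : Node (chain n)) → label u ≡ a
  label-chain zero    root         = refl
  label-chain (suc n) root         = refl
  label-chain (suc n) (below 0F u) = label-chain n u

  -- Two chains below a common root

  module Fork (n : ℕ) where

    Pos : Set
    Pos = Node (chain n)

    indexing : Pos ↔ Fin (suc n)
    indexing = mk↔ₛ′ (index n) (nodeAt n) (index-nodeAt n) (nodeAt-index n)

    _≟_ : DecidableEquality Pos
    _≟_ = inj⇒≟ (↔⇒↣ indexing)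

    anyPos? : {P : Pos → Set} → (∀ u → Dec (P u)) → Dec (∃ P)
    anyPos? {P} P? = map′ (λ (i , h) → nodeAt n i , h)
                          (λ (u , h) → index n u , subst P (sym (nodeAt-index n u)) h)
                          (any? (P? ∘ nodeAt n))

    ¬¬-∀Pos : {P : Pos → Set} → (∀ u → ¬ ¬ P u) → ¬ ¬ (∀ u → P u)
    ¬¬-∀Pos {P} h k =
      ¬¬-∀Fin (h ∘ nodeAt n) λ f → k λ u → subst P (nodeAt-index n u) (f (index n u))

    fork : Tree A
    fork = node a (chain n ∷ chain n ∷ [])

    at : Fin 2 → Pos → Node fork
    at 0F u = below 0F u
    at 1F u = below 1F u

    pos : Fin 2 → Node fork → Maybe Pos
    pos _  root         = nothing
    pos 0F (below 0F u) = just u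
    pos 0F (below 1F u) = nothing
    pos 1F (below 0F u) = nothing
    pos 1F (below 1F u) = just u

    ¬¬-∀Node : {P : Node fork → Set} → (∀ x → ¬ ¬ P x) → ¬ ¬ (∀ x → P x)
    ¬¬-∀Node h k =
      h root λ r → ¬¬-∀Pos (h ∘ below 0F) λ f → ¬¬-∀Pos (h ∘ below 1F) λ g →
      k λ { root → r ; (below 0F u) → f u ; (below 1F u) → g u }

    label-fork : (x : Node fork) → label x ≡ a
    label-fork root         = refl
    label-fork (below 0F u) = label-chain n u
    label-fork (below 1F u) = label-chain n u

    -- Vectors rather than functions: they can be searched exhaustively, and pointwise equal ones
    -- are equal.
    restrict : Fin 2 → NodeSet fork → Subset (suc n)
    restrict b X = Vec.tabulate (X ∘ at b ∘ nodeAt n)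

    lookup-restrict : ∀ b X u → Vec.lookup (restrict b X) (index n u) ≡ X (at b u)
    lookup-restrict b X u =
      trans (lookup∘tabulate (X ∘ at b ∘ nodeAt n) (index n u)) (cong (X ∘ at b) (nodeAt-index n u))

    -- The traces in the chains and the bit at the root can be chosen independently, which lets set
    -- quantifiers split over the parts.
    glue : Bool → (Fin 2 → Subset (suc n)) → NodeSet fork
    glue r S root         = r
    glue r S (below 0F u) = Vec.lookup (S 0F) (index n u)
    glue r S (below 1F u) = Vec.lookup (S 1F) (index n u)

    restrict-glue : ∀ r S b → restrict b (glue r S) ≡ S b
    restrict-glue r S 0F =
      trans (tabulate-cong (cong (Vec.lookup (S 0F)) ∘ index-nodeAt n)) (tabulate∘lookup _)
    restrict-glue r S 1F =
      trans (tabulate-cong (cong (Vec.lookup (S 1F)) ∘ index-nodeAt n)) (tabulate∘lookup _)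

    -- Transfer of the atomic relations

    data SamePart : Node fork → Node fork → Set where
      root  : SamePart root root
      left  : ∀ {u v} → SamePart (below 0F u) (below 0F v)
      right : ∀ {u v} → SamePart (below 1F u) (below 1F v)

    samePart-refl : ∀ x → SamePart x x
    samePart-refl root         = root
    samePart-refl (below 0F _) = left
    samePart-refl (below 1F _) = right

    samePart-sym : ∀ {x y} → SamePart x y → SamePart y x
    samePart-sym root  = root
    samePart-sym left  = left
    samePart-sym right = right

    -- Between different parts, the child, next-sibling and equality relations depend
    -- only on the parts and on which of the two nodes are topmost in their chains.
    -- The argument nothing stands for a node outside the chain.
    relCode : {R : Pos → Pos → Set} → (∀ u v → Dec (R u v)) → Maybe Pos → Maybe Pos → Fin 2
    relCode R? (just u) (just v) = bit (R? u v)
    relCode R? (just u) nothing  = bit (u ≟ root)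
    relCode R? nothing  (just v) = bit (v ≟ root)
    relCode R? nothing  nothing  = 0F

    siblingCode equalCode childCode : Maybe Pos → Maybe Pos → Fin 2
    siblingCode = relCode {R = λ _ _ → ⊥} λ _ _ → no λ ()
    equalCode   = relCode _≟_
    childCode   = relCode (child? n)

    Agree : (Maybe Pos → Maybe Pos → Fin 2) → (x y x′ y′ : Node fork) → Set
    Agree c x y x′ y′ = ∀ b → c (pos b x) (pos b y) ≡ c (pos b x′) (pos b y′)

    top-≡ : ∀ {u v : Pos} → bit (u ≟ root) ≡ bit (v ≟ root) → u ≡ root → v ≡ root
    top-≡ {u} {v} = bit-≡ {p? = u ≟ root} {v ≟ root}

    child-transfer : ∀ {x y x′ y′} → SamePart x x′ → SamePart y y′ →
                     Agree childCode x y x′ y′ → Child x y → Child x′ y′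
    -- A child of the root is topmost in its chain, which is what the code records when the other
    -- node is outside.
    child-transfer root left  e (top 0F) with refl ← top-≡ (e 0F) refl = top 0F
    child-transfer root right e (top 1F) with refl ← top-≡ (e 1F) refl = top 1F
    child-transfer (left  {u} {u′}) (left  {v} {v′}) e (down 0F c) =
      down 0F (bit-≡ {p? = child? n u v} {child? n u′ v′} (e 0F) c)
    child-transfer (right {u} {u′}) (right {v} {v′}) e (down 1F c) =
      down 1F (bit-≡ {p? = child? n u v} {child? n u′ v′} (e 1F) c)

    -- The only adjacent siblings are the two topmost nodes; each chain certifies its own one.
    nextSibling-transfer : ∀ {x y x′ y′} → SamePart x x′ → SamePart y y′ →
                           Agree siblingCode x y x′ y′ → NextSibling x y → NextSibling x′ y′
    nextSibling-transfer left right e (top 0F 1F refl)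
      with refl ← top-≡ (e 0F) refl with refl ← top-≡ (e 1F) refl = top 0F 1F refl
    nextSibling-transfer left  left  e (top 0F 0F ())
    nextSibling-transfer right right e (top 1F 1F ())
    nextSibling-transfer right left  e (top 1F 0F ())
    nextSibling-transfer left  left  e (down 0F s) = contradiction s (chain-¬nextSibling n)
    nextSibling-transfer right right e (down 1F s) = contradiction s (chain-¬nextSibling n)

    equal-transfer : ∀ {x y x′ y′} → SamePart x x′ → SamePart y y′ →
                     Agree equalCode x y x′ y′ → x ≡ y → x′ ≡ y′
    equal-transfer root root e refl = refl
    equal-transfer (left  {u} {u′}) (left  {_} {v′}) e refl =
      cong (below 0F) (bit-≡ {p? = u ≟ u} {u′ ≟ v′} (e 0F) refl)
    equal-transfer (right {u} {u′}) (right {_} {v′}) e refl =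
      cong (below 1F) (bit-≡ {p? = u ≟ u} {u′ ≟ v′} (e 1F) refl)

    agree-lookup : ∀ {m} c (ρ ρ′ : Vec (Node fork) m) x y →
                   (∀ b → c (Vec.lookup (Vec.map (pos b) ρ) x) (Vec.lookup (Vec.map (pos b) ρ) y) ≡
                          c (Vec.lookup (Vec.map (pos b) ρ′) x) (Vec.lookup (Vec.map (pos b) ρ′) y)) →
                   Agree c (Vec.lookup ρ x) (Vec.lookup ρ y) (Vec.lookup ρ′ x) (Vec.lookup ρ′ y)
    agree-lookup c ρ ρ′ x y e b =
      trans (sym (code-lookup ρ)) (trans (e b) (code-lookup ρ′))
      where
      code-lookup : ∀ π → c (Vec.lookup (Vec.map (pos b) π) x) (Vec.lookup (Vec.map (pos b) π) y) ≡
                          c (pos b (Vec.lookup π x)) (pos b (Vec.lookup π y))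
      code-lookup π = cong₂ c (lookup-map x (pos b) π) (lookup-map y (pos b) π)

    -- Feferman-Vaught types and their composition

    module Types {p} {P : Fin p → Node fork → Set} (P? : ∀ r x → Dec (P r x)) where

      predCode : Fin 2 → Fin p → Maybe Pos → Fin 2
      predCode b r (just u) = bit (P? r (at b u))
      predCode b r nothing  = 0F

      memberCode : Maybe Pos → Subset (suc n) → Fin 2
      memberCode (just u) X = bit (T? (Vec.lookup X (index n u)))
      memberCode nothing  X = 0F

      -- code b φ ρ σ is the Feferman–Vaught type of (ρ, σ) in chain b relative to φ.
      code : ∀ {m s} → Fin 2 → (φ : MSO A p m s) →
             Vec (Maybe Pos) m → Vec (Subset (suc n)) s → Fin (size φ)

      -- The set of types reachable from inside, paired with the type for an outside node, serves
      -- both node quantifiers.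
      nodeCode : ∀ {m s} → Fin 2 → (φ : MSO A p (suc m) s) →
                 Vec (Maybe Pos) m → Vec (Subset (suc n)) s → Fin (2 ^ size φ * size φ)
      setCode : ∀ {m s} → Fin 2 → (φ : MSO A p m (suc s)) →
                Vec (Maybe Pos) m → Vec (Subset (suc n)) s → Fin (2 ^ size φ)

      code b (letter _ _)      ρ σ = 0F
      code b (pred r x)        ρ σ = predCode b r (Vec.lookup ρ x)
      code b (child x y)       ρ σ = childCode (Vec.lookup ρ x) (Vec.lookup ρ y)
      code b (nextSibling x y) ρ σ = siblingCode (Vec.lookup ρ x) (Vec.lookup ρ y)
      code b (equal x y)       ρ σ = equalCode (Vec.lookup ρ x) (Vec.lookup ρ y)
      code b (member x X)      ρ σ = memberCode (Vec.lookup ρ x) (Vec.lookup σ X)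
      code b (not φ)           ρ σ = code b φ ρ σ
      code b (and φ χ)         ρ σ = combine (code b φ ρ σ) (code b χ ρ σ)
      code b (or φ χ)          ρ σ = combine (code b φ ρ σ) (code b χ ρ σ)
      code b (implies φ χ)     ρ σ = combine (code b φ ρ σ) (code b χ ρ σ)
      code b (existsNode φ)    ρ σ = nodeCode b φ ρ σ
      code b (allNodes φ)      ρ σ = nodeCode b φ ρ σ
      code b (existsSet φ)     ρ σ = setCode b φ ρ σ
      code b (allSets φ)       ρ σ = setCode b φ ρ σ

      nodeCode b φ ρ σ =
        combine (image inside λ c → anyPos? λ u → inside u Fin.≟ c) (code b φ (nothing ∷ ρ) σ)
        where inside = λ u → code b φ (just u ∷ ρ) σ
      setCode b φ ρ σ =
        image inside λ c → anySubset? λ X → inside X Fin.≟ c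
        where inside = λ X → code b φ ρ (X ∷ σ)

      pred-transfer : ∀ r {x x′} → SamePart x x′ →
                      (∀ b → predCode b r (pos b x) ≡ predCode b r (pos b x′)) → P r x → P r x′
      pred-transfer r root e = λ h → h
      pred-transfer r (left  {u} {v}) e = bit-≡ {p? = P? r (below 0F u)} {P? r (below 0F v)} (e 0F)
      pred-transfer r (right {u} {v}) e = bit-≡ {p? = P? r (below 1F u)} {P? r (below 1F v)} (e 1F)

      member-transfer : ∀ {x x′} X X′ → SamePart x x′ → X root ≡ X′ root →
                        (∀ b → memberCode (pos b x) (restrict b X) ≡
                               memberCode (pos b x′) (restrict b X′)) → T (X x) → T (X′ x′)
      member-transfer X X′ root r e = subst T r
      member-transfer X X′ (left {u} {v}) r e h =
        subst T (lookup-restrict 0F X′ v)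
          (bit-≡ {p? = T? _} {T? _} (e 0F) (subst T (sym (lookup-restrict 0F X u)) h))
      member-transfer X X′ (right {u} {v}) r e h =
        subst T (lookup-restrict 1F X′ v)
          (bit-≡ {p? = T? _} {T? _} (e 1F) (subst T (sym (lookup-restrict 1F X u)) h))

      nodeCode-≡ : ∀ {m s} b (φ : MSO A p (suc m) s) ρ ρ′ σ σ′ →
                   nodeCode b φ ρ σ ≡ nodeCode b φ ρ′ σ′ →
                   (∀ u → ∃[ v ] code b φ (just u ∷ ρ) σ ≡ code b φ (just v ∷ ρ′) σ′) ×
                   code b φ (nothing ∷ ρ) σ ≡ code b φ (nothing ∷ ρ′) σ′
      nodeCode-≡ b φ ρ ρ′ σ σ′ e =
        Product.map₁ image-≡ (combine-injective {m = 2 ^ size φ} {n = size φ} _ _ _ _ e)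

      code-at : ∀ {m s} → Fin 2 → (φ : MSO A p m s) → Vec (Node fork) m → Vec (NodeSet fork) s →
                Fin (size φ)
      code-at b φ ρ σ = code b φ (Vec.map (pos b) ρ) (Vec.map (restrict b) σ)

      -- The chain containing `x` answers by equality of images; any other chain sees `x` as
      -- `nothing` and uses the second component.
      nodeCode-extend : ∀ {m s} (φ : MSO A p (suc m) s) ρ ρ′ σ σ′ →
                        (∀ b → code-at b (existsNode φ) ρ σ ≡ code-at b (existsNode φ) ρ′ σ′) →
                        ∀ x → ∃[ x′ ] SamePart x x′ ×
                          (∀ b → code-at b φ (x ∷ ρ) σ ≡ code-at b φ (x′ ∷ ρ′) σ′)
      nodeCode-extend φ ρ ρ′ σ σ′ e = extend
        where
        split = λ b → nodeCode-≡ b φ _ (Vec.map (pos b) ρ′) _ (Vec.map (restrict b) σ′) (e b)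
        extend : ∀ x → ∃[ x′ ] SamePart x x′ ×
                   (∀ b → code-at b φ (x ∷ ρ) σ ≡ code-at b φ (x′ ∷ ρ′) σ′)
        extend root = root , root , proj₂ ∘ split
        extend (below 0F u) with v , h ← proj₁ (split 0F) u =
          below 0F v , left , λ { 0F → h ; 1F → proj₂ (split 1F) }
        extend (below 1F u) with v , h ← proj₁ (split 1F) u =
          below 1F v , right , λ { 0F → proj₂ (split 0F) ; 1F → h }

      -- Each chain answers for its own trace, and the answers are glued with the root bit of `X`
      -- kept.
      setCode-extend : ∀ {m s} (φ : MSO A p m (suc s)) ρ ρ′ σ σ′ →
                       (∀ b → code-at b (existsSet φ) ρ σ ≡ code-at b (existsSet φ) ρ′ σ′) →
                       ∀ X → ∃[ X′ ] X root ≡ X′ root ×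
                         (∀ b → code-at b φ ρ (X ∷ σ) ≡ code-at b φ ρ′ (X′ ∷ σ′))
      setCode-extend φ ρ ρ′ σ σ′ e X =
        glue (X root) S , refl , λ b →
          trans (proj₂ (parts b))
                (cong (λ Y → code b φ (Vec.map (pos b) ρ′) (Y ∷ Vec.map (restrict b) σ′))
                      (sym (restrict-glue (X root) S b)))
        where
        parts : ∀ b → ∃[ Y ] code-at b φ ρ (X ∷ σ) ≡
                             code b φ (Vec.map (pos b) ρ′) (Y ∷ Vec.map (restrict b) σ′)
        parts b = image-≡ (e b) (restrict b X)
        S = proj₁ ∘ parts

      -- The information that the two chain types leave out.
      record Similar {m s} (ρ ρ′ : Vec (Node fork) m) (σ σ′ : Vec (NodeSet fork) s) : Set where
        constructor similar
        field
          samePart : ∀ x → SamePart (Vec.lookup ρ x) (Vec.lookup ρ′ x)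
          sameRoot : ∀ X → Vec.lookup σ X root ≡ Vec.lookup σ′ X root

      open Similar

      similar-sym : ∀ {m s} {ρ ρ′ : Vec (Node fork) m} {σ σ′ : Vec (NodeSet fork) s} →
                    Similar ρ ρ′ σ σ′ → Similar ρ′ ρ σ′ σ
      similar-sym (similar ss rs) = similar (samePart-sym ∘ ss) (sym ∘ rs)

      similar-node : ∀ {m s} {ρ ρ′ : Vec (Node fork) m} {σ σ′ : Vec (NodeSet fork) s} {x x′} →
                     Similar ρ ρ′ σ σ′ → SamePart x x′ → Similar (x ∷ ρ) (x′ ∷ ρ′) σ σ′
      similar-node (similar ss rs) s = similar (λ { zero → s ; (suc x) → ss x }) rs

      similar-set : ∀ {m s} {ρ ρ′ : Vec (Node fork) m} {σ σ′ : Vec (NodeSet fork) s}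
                      {X X′ : NodeSet fork} →
                    Similar ρ ρ′ σ σ′ → X root ≡ X′ root → Similar ρ ρ′ (X ∷ σ) (X′ ∷ σ′)
      similar-set (similar ss rs) r = similar ss λ { zero → r ; (suc X) → rs X }

      combine-≡ : ∀ {m s} (φ χ : MSO A p m s) ρ ρ′ σ σ′ →
                  (∀ b → combine (code-at b φ ρ σ) (code-at b χ ρ σ) ≡
                         combine (code-at b φ ρ′ σ′) (code-at b χ ρ′ σ′)) →
                  (∀ b → code-at b φ ρ σ ≡ code-at b φ ρ′ σ′) ×
                  (∀ b → code-at b χ ρ σ ≡ code-at b χ ρ′ σ′)
      combine-≡ φ χ ρ ρ′ σ σ′ e = (λ b → proj₁ (split b)) , (λ b → proj₂ (split b))
        where split = λ b → combine-injective (code-at b φ ρ σ) (code-at b χ ρ σ) _ _ (e b)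

      -- The composition theorem, by induction on the formula: quantifiers are back-and-forth moves,
      -- and negative positions use the symmetric hypotheses.
      transfer : ∀ {m s} (φ : MSO A p m s) (ρ ρ′ : Vec (Node fork) m) (σ σ′ : Vec (NodeSet fork) s) →
                 Similar ρ ρ′ σ σ′ → (∀ b → code-at b φ ρ σ ≡ code-at b φ ρ′ σ′) →
                 holds fork P φ ρ σ → holds fork P φ ρ′ σ′
      transfer (letter l x) ρ ρ′ σ σ′ S e h =
        trans (label-fork (Vec.lookup ρ′ x)) (trans (sym (label-fork (Vec.lookup ρ x))) h)
      transfer (pred r x) ρ ρ′ σ σ′ S e = pred-transfer r (samePart S x) λ b →
        subst₂ (λ u v → predCode b r u ≡ predCode b r v)
               (lookup-map x (pos b) ρ) (lookup-map x (pos b) ρ′) (e b)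
      transfer (child x y) ρ ρ′ σ σ′ S e =
        child-transfer (samePart S x) (samePart S y) (agree-lookup childCode ρ ρ′ x y e)
      transfer (nextSibling x y) ρ ρ′ σ σ′ S e =
        nextSibling-transfer (samePart S x) (samePart S y) (agree-lookup siblingCode ρ ρ′ x y e)
      transfer (equal x y) ρ ρ′ σ σ′ S e =
        equal-transfer (samePart S x) (samePart S y) (agree-lookup equalCode ρ ρ′ x y e)
      transfer (member x X) ρ ρ′ σ σ′ S e =
        member-transfer (Vec.lookup σ X) (Vec.lookup σ′ X) (samePart S x) (sameRoot S X) λ b →
          trans (sym (cong₂ memberCode (lookup-map x (pos b) ρ) (lookup-map X (restrict b) σ)))
            (trans (e b) (cong₂ memberCode (lookup-map x (pos b) ρ′) (lookup-map X (restrict b) σ′)))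
      transfer (not φ) ρ ρ′ σ σ′ S e h = h ∘ transfer φ ρ′ ρ σ′ σ (similar-sym S) (sym ∘ e)
      transfer (and φ χ) ρ ρ′ σ σ′ S e =
        let eφ , eχ = combine-≡ φ χ ρ ρ′ σ σ′ e
        in Product.map (transfer φ ρ ρ′ σ σ′ S eφ) (transfer χ ρ ρ′ σ σ′ S eχ)
      transfer (or φ χ) ρ ρ′ σ σ′ S e =
        let eφ , eχ = combine-≡ φ χ ρ ρ′ σ σ′ e
        in Sum.map (transfer φ ρ ρ′ σ σ′ S eφ) (transfer χ ρ ρ′ σ σ′ S eχ)
      transfer (implies φ χ) ρ ρ′ σ σ′ S e h =
        let eφ , eχ = combine-≡ φ χ ρ ρ′ σ σ′ e
        in transfer χ ρ ρ′ σ σ′ S eχ ∘ h ∘ transfer φ ρ′ ρ σ′ σ (similar-sym S) (sym ∘ eφ)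
      transfer (existsNode φ) ρ ρ′ σ σ′ S e (x , h) =
        let x′ , s , e′ = nodeCode-extend φ ρ ρ′ σ σ′ e x
        in x′ , transfer φ (x ∷ ρ) (x′ ∷ ρ′) σ σ′ (similar-node S s) e′ h
      transfer (allNodes φ) ρ ρ′ σ σ′ S e h x′ =
        let x , s , e′ = nodeCode-extend φ ρ′ ρ σ′ σ (sym ∘ e) x′
        in transfer φ (x ∷ ρ) (x′ ∷ ρ′) σ σ′ (similar-node S (samePart-sym s)) (sym ∘ e′) (h x)
      transfer (existsSet φ) ρ ρ′ σ σ′ S e (X , h) =
        let X′ , r , e′ = setCode-extend φ ρ ρ′ σ σ′ e X
        in X′ , transfer φ ρ ρ′ (X ∷ σ) (X′ ∷ σ′) (similar-set S r) e′ h
      transfer (allSets φ) ρ ρ′ σ σ′ S e h X′ =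
        let X , r , e′ = setCode-extend φ ρ′ ρ σ′ σ (sym ∘ e) X′
        in transfer φ ρ ρ′ (X ∷ σ) (X′ ∷ σ′) (similar-set S (sym r)) (sym ∘ e′) (h X)

    -- Colours of positions relative to a query

    module Colours {D : Set} (f₁ f₂ : Node fork → D) where

      dataTree : DataTree A D
      dataTree = record { tree = fork ; d₁ = f₁ ; d₂ = f₂ }

      -- The types need the nested queries to be decidable. That is available under ¬¬,
      -- which suffices because the theorem is a negation.
      Decided : ∀ {m} → XPath A m → Set
      Decided (mso Γ φ)       = ∀ r → (∀ x → Dec (satisfies dataTree (Γ r) (x ∷ []))) × Decided (Γ r)
      Decided (dataEq _ _ φ)  = Decided φ
      Decided (dataNeq _ _ φ) = Decided φ

      ¬¬-decided : ∀ {m} (φ : XPath A m) → ¬ ¬ Decided φ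
      ¬¬-decided (mso Γ φ) = ¬¬-∀Fin λ r k →
        ¬¬-∀Node (λ _ → ¬¬-excluded-middle) λ d → ¬¬-decided (Γ r) λ δ → k (d , δ)
      ¬¬-decided (dataEq _ _ φ)  = ¬¬-decided φ
      ¬¬-decided (dataNeq _ _ φ) = ¬¬-decided φ

      -- The type of a tuple with just one component in chain `b`. Nodes are later moved only in
      -- this situation, so colouring single positions suffices.
      soloCode : ∀ {p m} (Γ : Fin p → XPath A 1) (φ : MSO A p m 0) → Decided (mso {m = m} Γ φ) →
                 Pos → Fin 2 → Fin m → Fin (size φ)
      soloCode Γ φ δ u b y =
        Types.code (λ r → proj₁ (δ r)) b φ (replicate _ nothing [ y ]≔ just u) []

      colour : ∀ {m} (φ : XPath A m) → Decided φ → Pos → Fin (total φ)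
      colour (mso Γ φ) δ u =
        combine (funToFin λ b → funToFin (soloCode Γ φ δ u b))
                (tuple λ r → colour (Γ r) (proj₂ (δ r)) u)
      colour (dataEq _ _ φ)  = colour φ
      colour (dataNeq _ _ φ) = colour φ

      colour-≡ : ∀ {p m} (Γ : Fin p → XPath A 1) (φ : MSO A p m 0) (δ : Decided (mso {m = m} Γ φ)) u v →
                 colour (mso Γ φ) δ u ≡ colour (mso Γ φ) δ v →
                 (∀ b y → soloCode Γ φ δ u b y ≡ soloCode Γ φ δ v b y) ×
                 (∀ r → colour (Γ r) (proj₂ (δ r)) u ≡ colour (Γ r) (proj₂ (δ r)) v)
      colour-≡ Γ φ δ u v e =
        let codes , colours = combine-injective (funToFin (solo u)) (nested u) (funToFin (solo v)) (nested v) e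
        in (λ b → funToFin-injective _ _ (funToFin-injective (solo u) (solo v) codes b)) ,
           tuple-injective _ _ colours
        where
        solo   = λ w b → funToFin (soloCode Γ φ δ w b)
        nested = λ w → tuple λ r → colour (Γ r) (proj₂ (δ r)) w

    -- The abstract data value: the position, regardless of the chain, with a separate value for the
    -- root.
    val : Node fork → Maybe Pos
    val root         = nothing
    val (below 0F u) = just u
    val (below 1F u) = just u

    -- Exchange of two positions in one chain

    module Exchange (p q : Pos) where

      open Transposition _≟_ p q

      -- Besides moving witnesses, it yields the altered second data function `val ∘ τ 1F`.
      τ : Fin 2 → Node fork → Node fork
      τ _  root         = root
      τ 0F (below 0F u) = below 0F (swap u)
      τ 0F (below 1F u) = below 1F u
      τ 1F (below 0F u) = below 0F u
      τ 1F (below 1F u) = below 1F (swap u)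

      τ-samePart : ∀ b y → SamePart y (τ b y)
      τ-samePart _  root         = root
      τ-samePart 0F (below 0F u) = left
      τ-samePart 0F (below 1F u) = right
      τ-samePart 1F (below 0F u) = left
      τ-samePart 1F (below 1F u) = right

      τ-fixed : ∀ b y → pos b y ≡ nothing → τ b y ≡ y
      τ-fixed _  root         _ = refl
      τ-fixed 0F (below 0F u) ()
      τ-fixed 0F (below 1F u) _ = refl
      τ-fixed 1F (below 0F u) _ = refl
      τ-fixed 1F (below 1F u) ()

      τ₁-involutive : ∀ y → τ 1F (τ 1F y) ≡ y
      τ₁-involutive root         = refl
      τ₁-involutive (below 0F u) = refl
      τ₁-involutive (below 1F u) = cong (below 1F) (swap-involutive u)

      τ-comm : ∀ y → τ 1F (τ 0F y) ≡ τ 0F (τ 1F y)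
      τ-comm root         = refl
      τ-comm (below 0F u) = refl
      τ-comm (below 1F u) = refl

      val-ττ : ∀ y → val (τ 1F (τ 0F y)) ≡ Maybe.map swap (val y)
      val-ττ root         = refl
      val-ττ (below 0F u) = refl
      val-ττ (below 1F u) = refl

      -- Chain `b` notices `τ c` only if `b` is `c`, so only then must `f` agree at `p` and `q`.
      pos-τ-invariant : ∀ {X : Set} b c (f : Maybe Pos → X) → (b ≡ c → f (just p) ≡ f (just q)) →
                        ∀ y → f (pos b y) ≡ f (pos b (τ c y))
      pos-τ-invariant b  c  f e root         = refl
      pos-τ-invariant 0F 0F f e (below 0F u) = sym (swap-invariant (f ∘ just) (e refl) u)
      pos-τ-invariant 0F 0F f e (below 1F u) = refl
      pos-τ-invariant 0F 1F f e (below 0F u) = refl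
      pos-τ-invariant 0F 1F f e (below 1F u) = refl
      pos-τ-invariant 1F 0F f e (below 0F u) = refl
      pos-τ-invariant 1F 0F f e (below 1F u) = refl
      pos-τ-invariant 1F 1F f e (below 0F u) = refl
      pos-τ-invariant 1F 1F f e (below 1F u) = sym (swap-invariant (f ∘ just) (e refl) u)

      -- The changes of witnesses that types cannot detect: a node is moved only in a chain that
      -- misses the other two.
      data Move (x y₁ y₂ : Node fork) : Node fork → Node fork → Set where
        stay  : Move x y₁ y₂ y₁ y₂
        move₁ : ∀ b → pos b x ≡ nothing → pos b y₂ ≡ nothing → Move x y₁ y₂ (τ b y₁) y₂
        move₂ : ∀ b → pos b x ≡ nothing → pos b y₁ ≡ nothing → Move x y₁ y₂ y₁ (τ b y₂)

      -- τ 1F ∘ τ 0F exchanges p and q in both chains.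
      Rigid : {X : Set} → (Node fork → X) → Set
      Rigid v = ∀ y₁ y₂ → (v y₁ ≡ v y₂) ⇔ (v (τ 1F (τ 0F y₁)) ≡ v (τ 1F (τ 0F y₂)))

      outside : ∀ y → pos 1F y ≡ nothing ⊎ pos 0F y ≡ nothing
      outside root         = inj₁ refl
      outside (below 0F u) = inj₁ refl
      outside (below 1F u) = inj₂ refl

      module _ {X : Set} (v v′ : Node fork → X) (v′-τ : ∀ y → v′ y ≡ v (τ 1F y)) (rigid : Rigid v) where

        exchange : ∀ x y₁ y₂ → ∃[ z₁ ] ∃[ z₂ ] Move x y₁ y₂ z₁ z₂ × (v y₁ ≡ v y₂) ⇔ (v′ z₁ ≡ v′ z₂)
        exchange x y₁ y₂ = case (outside x , outside y₁ , outside y₂) of λ where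
            (_ , inj₁ o₁ , inj₁ o₂) → y₁ , y₂ , stay , ≡-resp (fixed₁ y₁ o₁) (fixed₁ y₂ o₂)
            -- Both values undergo the exchange together, so `Rigid` preserves their equality or
            -- inequality.
            (_ , inj₂ o₁ , inj₂ o₂) →
              y₁ , y₂ , stay , ⇔.trans (rigid y₁ y₂) (≡-resp (fixed₀ y₁ o₁) (fixed₀ y₂ o₂))
            -- Moving `y₂` in the altered chain restores its value exactly.
            (inj₁ o , inj₁ o₁ , inj₂ o₂) →
              y₁ , τ 1F y₂ , move₂ 1F o o₁ , ≡-resp (fixed₁ y₁ o₁) (moved₁ y₂)
            -- Here `x` lies in the altered chain, so `y₁` is moved on the other side: then both
            -- values are exchanged, and `Rigid` applies again.
            (inj₂ o , inj₁ o₁ , inj₂ o₂) →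
              τ 0F y₁ , y₂ , move₁ 0F o o₂ ,
              ⇔.trans (rigid y₁ y₂) (≡-resp (moved₀ y₁) (fixed₀ y₂ o₂))
            (inj₁ o , inj₂ o₁ , inj₁ o₂) →
              τ 1F y₁ , y₂ , move₁ 1F o o₂ , ≡-resp (moved₁ y₁) (fixed₁ y₂ o₂)
            (inj₂ o , inj₂ o₁ , inj₁ o₂) →
              y₁ , τ 0F y₂ , move₂ 0F o o₁ ,
              ⇔.trans (rigid y₁ y₂) (≡-resp (fixed₀ y₁ o₁) (moved₀ y₂))
          where
          fixed₁ : ∀ y → pos 1F y ≡ nothing → v y ≡ v′ y
          fixed₁ y o = sym (trans (v′-τ y) (cong v (τ-fixed 1F y o)))
          moved₁ : ∀ y → v y ≡ v′ (τ 1F y)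
          moved₁ y = sym (trans (v′-τ (τ 1F y)) (cong v (τ₁-involutive y)))
          moved₀ : ∀ y → v (τ 1F (τ 0F y)) ≡ v′ (τ 0F y)
          moved₀ y = sym (v′-τ (τ 0F y))
          fixed₀ : ∀ y → pos 0F y ≡ nothing → v (τ 1F (τ 0F y)) ≡ v′ y
          fixed₀ y o = trans (moved₀ y) (cong v′ (τ-fixed 0F y o))

      val-rigid : Rigid val
      val-rigid y₁ y₂ =
        ⇔.trans (mk⇔ (cong (Maybe.map swap)) (map-injective swap-injective))
                (≡-resp (sym (val-ττ y₁)) (sym (val-ττ y₂)))

      val-τ-rigid : Rigid (val ∘ τ 1F)
      val-τ-rigid y₁ y₂ =
        ⇔.trans (val-rigid (τ 1F y₁) (τ 1F y₂))
                (≡-resp (cong (val ∘ τ 1F) (sym (τ-comm y₁))) (cong (val ∘ τ 1F) (sym (τ-comm y₂))))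

      -- Indistinguishability of the two data trees

      module _ {D : Set} (enc : Fin 2 → Maybe Pos → D)
               (enc-injective : ∀ {i j w w′} → enc i w ≡ enc j w′ → i ≡ j × w ≡ w′) where

        open Colours (enc 0F ∘ val) (enc 1F ∘ val)

        valued : (Node fork → Maybe Pos) → DataTree A D
        valued v = Colours.dataTree (enc 0F ∘ val) (enc 1F ∘ v)

        exchange-d : ∀ v v′ → (∀ y → v′ y ≡ v (τ 1F y)) → Rigid v → ∀ i j x y₁ y₂ →
                     ∃[ z₁ ] ∃[ z₂ ] Move x y₁ y₂ z₁ z₂ ×
                     (DataTree.d (valued v) i y₁ ≡ DataTree.d (valued v) j y₂) ⇔
                     (DataTree.d (valued v′) i z₁ ≡ DataTree.d (valued v′) j z₂)
        exchange-d v v′ e rigid 0F 0F x y₁ y₂ = y₁ , y₂ , stay , ⇔.refl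
        -- The two data functions have disjoint ranges, so both equations are false.
        exchange-d v v′ e rigid 0F 1F x y₁ y₂ = y₁ , y₂ , stay ,
          mk⇔ (λ h → case proj₁ (enc-injective h) of λ ()) (λ h → case proj₁ (enc-injective h) of λ ())
        exchange-d v v′ e rigid 1F 0F x y₁ y₂ = y₁ , y₂ , stay ,
          mk⇔ (λ h → case proj₁ (enc-injective h) of λ ()) (λ h → case proj₁ (enc-injective h) of λ ())
        exchange-d v v′ e rigid 1F 1F x y₁ y₂ =
          let z₁ , z₂ , μ , h = exchange v v′ e rigid x y₁ y₂
              enc-⇔ = λ {w w′} → mk⇔ (cong (enc 1F)) (proj₂ ∘ enc-injective {1F} {1F} {w} {w′})
          in z₁ , z₂ , μ , ⇔.trans (⇔.sym enc-⇔) (⇔.trans h enc-⇔)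

        Unnoticed : ∀ {m} (φ : XPath A m) → Decided φ → Set
        Unnoticed φ δ = colour φ δ p ≡ colour φ δ q

        -- Both tuples live in the unaltered data tree, for which the colours are computed, and they
        -- have equal types in both chains.
        move-invariant : (φ : XPath A 3) (δ : Decided φ) → Unnoticed φ δ →
                         ∀ {x y₁ y₂ z₁ z₂} → Move x y₁ y₂ z₁ z₂ →
                         satisfies (valued val) φ (x ∷ y₁ ∷ y₂ ∷ []) →
                         satisfies (valued val) φ (x ∷ z₁ ∷ z₂ ∷ [])
        move-invariant φ δ e stay h = h
        move-invariant (mso Γ φ) δ e {x} {y₁} {y₂} (move₁ c o o₂) =
          transfer φ _ _ [] []
            (similar (λ { 0F → samePart-refl x ; 1F → τ-samePart c y₁ ; 2F → samePart-refl y₂ }) λ ())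
            λ b → pos-τ-invariant b c (λ w → code b φ (pos b x ∷ w ∷ pos b y₂ ∷ []) [])
                    -- In the chain of the move, `x` and `y₂` are `nothing`, so this is the solo
                    -- tuple with variable 1 that the colour records.
                    (λ { refl → subst₂ (λ wx w₂ → code b φ (wx ∷ just p ∷ w₂ ∷ []) [] ≡
                                                  code b φ (wx ∷ just q ∷ w₂ ∷ []) [])
                                       (sym o) (sym o₂) (proj₁ (colour-≡ Γ φ δ p q e) b 1F) })
                    y₁
          where open Types (λ r → proj₁ (δ r))
        move-invariant (mso Γ φ) δ e {x} {y₁} {y₂} (move₂ c o o₁) =
          transfer φ _ _ [] []
            (similar (λ { 0F → samePart-refl x ; 1F → samePart-refl y₁ ; 2F → τ-samePart c y₂ }) λ ())
            λ b → pos-τ-invariant b c (λ w → code b φ (pos b x ∷ pos b y₁ ∷ w ∷ []) [])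
                    (λ { refl → subst₂ (λ wx w₁ → code b φ (wx ∷ w₁ ∷ just p ∷ []) [] ≡
                                                  code b φ (wx ∷ w₁ ∷ just q ∷ []) [])
                                       (sym o) (sym o₁) (proj₁ (colour-≡ Γ φ δ p q e) b 2F) })
                    y₂
          where open Types (λ r → proj₁ (δ r))

        -- By induction on the query. For a data test, `exchange-d` repairs the comparison by a
        -- `Move`, `move-invariant` carries the inner query through the move, and the induction
        -- hypothesis changes the data tree.
        indistinguishable : ∀ {m} (φ : XPath A m) (δ : Decided φ) → Unnoticed φ δ → ∀ ρ →
                            satisfies (valued val) φ ρ ⇔ satisfies (valued (val ∘ τ 1F)) φ ρ
        indistinguishable (mso Γ φ) δ e ρ =
          holds-cong fork
            (λ r x → indistinguishable (Γ r) (proj₂ (δ r)) (proj₂ (colour-≡ Γ φ δ p q e) r) (x ∷ []))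
            φ ρ []
        indistinguishable (dataEq i j φ) δ e (x ∷ []) = mk⇔
          (λ (y₁ , y₂ , d , h) →
            let z₁ , z₂ , μ , d⇔ = exchange-d val (val ∘ τ 1F) (λ _ → refl) val-rigid i j x y₁ y₂
            in z₁ , z₂ , to d⇔ d , to (indistinguishable φ δ e _) (move-invariant φ δ e μ h))
          (λ (y₁ , y₂ , d , h) →
            let z₁ , z₂ , μ , d⇔ =
                  exchange-d (val ∘ τ 1F) val (cong val ∘ sym ∘ τ₁-involutive) val-τ-rigid i j x y₁ y₂
            -- In this direction the data tree is changed first, since moves are justified only in
            -- the unaltered one.
            in z₁ , z₂ , to d⇔ d , move-invariant φ δ e μ (from (indistinguishable φ δ e _) h))
        indistinguishable (dataNeq i j φ) δ e (x ∷ []) = mk⇔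
          (λ (y₁ , y₂ , d , h) →
            let z₁ , z₂ , μ , d⇔ = exchange-d val (val ∘ τ 1F) (λ _ → refl) val-rigid i j x y₁ y₂
            in z₁ , z₂ , d ∘ from d⇔ , to (indistinguishable φ δ e _) (move-invariant φ δ e μ h))
          (λ (y₁ , y₂ , d , h) →
            let z₁ , z₂ , μ , d⇔ =
                  exchange-d (val ∘ τ 1F) val (cong val ∘ sym ∘ τ₁-involutive) val-τ-rigid i j x y₁ y₂
            in z₁ , z₂ , d ∘ from d⇔ , move-invariant φ δ e μ (from (indistinguishable φ δ e _) h))

        ψ-valued : ψ (valued val)
        ψ-valued x y = mk⇔ (cong (enc 1F) ∘ proj₂ ∘ enc-injective) (cong (enc 0F) ∘ proj₂ ∘ enc-injective)

        -- The two nodes at position `p` share their first value, but their second values now come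
        -- from `p` and `q`.
        ¬ψ-swapped : p ≢ q → ¬ ψ (valued (val ∘ τ 1F))
        ¬ψ-swapped p≢q h =
          p≢q (trans (just-injective (proj₂ (enc-injective (to (h (below 0F p) (below 1F p)) refl)))) swap-p)

-- The pigeonhole argument and the choice of data values

theorem6 : (A : Set) (k : ℕ) → A ↔ Fin (suc k) →
    (D : Set) → ℕ ↣ D →
    ¬ (∃[ φ ] ((𝒯 : DataTree A D) → (𝒯 ⊨ φ) ⇔ ψ 𝒯))
theorem6 A k letters D ι (φ , defines) = ¬¬-decided φ λ δ →
  -- `chain n` has n + 1 nodes, one more than there are colours when n is `total φ`.
  let i , j , i<j , same = pigeonhole (n<1+n (total φ)) (colour φ δ ∘ nodeAt (total φ))
      p = nodeAt (total φ) i
      q = nodeAt (total φ) j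
      open Exchange p q
      p≢q = <⇒≢ i<j ∘ Injection.injective (↔⇒↣ (↔-sym indexing))
  in ¬ψ-swapped enc enc-injective p≢q
       (to (defines _) (to (indistinguishable enc enc-injective φ δ same [])
         (from (defines _) (ψ-valued enc enc-injective))))
  where
  -- Nonemptiness of the alphabet provides the common label.
  open Chains (Inverse.from letters zero)
  open Fork (total φ)

  slot : Maybe Pos → Fin (2 + total φ)
  slot nothing  = zero
  slot (just u) = suc (index (total φ) u)

  slot-injective : ∀ {w w′} → slot w ≡ slot w′ → w ≡ w′
  slot-injective {nothing} {nothing} _ = refl
  slot-injective {just _}  {just _}  e = cong just (Injection.injective (↔⇒↣ indexing) (suc-injective e))

  -- Numbering pairs makes the ranges for the two indices disjoint, including the values at the
  -- root.
  enc : Fin 2 → Maybe Pos → D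
  enc i w = Injection.to ι (toℕ (combine i (slot w)))

  enc-injective : ∀ {i j w w′} → enc i w ≡ enc j w′ → i ≡ j × w ≡ w′
  enc-injective e =
    Product.map₂ slot-injective
      (combine-injective _ _ _ _ (toℕ-injective (Injection.injective ι e)))

  open Colours (enc 0F ∘ val) (enc 1F ∘ val)
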